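{- Let $G$ be a nontrivial connected graph and let $\Gamma$ be a family of nontrivial connected graphs such that $V(F)=V$ for every $F\in\Gamma$. Consider any function $h:E(G)\to\Gamma$. Then $G\otimes_h\Gamma$ is connected if and only if at least one of $G$ or $h(G)$ is nonbipartite.
   Context: All graphs are finite and simple. A graph is nontrivial if it has at least two vertices. Let $G$ be a graph, $\Gamma$ a family of graphs all having the same vertex set $V$, and $h:E(G)\to\Gamma$ a function. The product $G\otimes_h\Gamma$ is the graph with vertex set $V(G)\times V$ in which $(a,x)(b,y)$ is an edge if and only if $ab\in E(G)$ and $xy\in E(h(ab))$. The graph $h(G)$ is the graph with vertex set $V$ and edge set $\bigcup_{e\in E(G)}E(h(e))$. -}

module Defs where

open import Data.Bool.Base using (Bool)
open import Data.Fin.Base using (Fin)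
open import Data.Fin.Properties using (any?; *↔×)
open import Data.Nat.Base using (ℕ; _*_; _≤_)
open import Data.Product.Base using (Σ; Σ-syntax; ∃; ∃-syntax; _×_; _,_)
open import Data.Product.Function.NonDependent.Propositional using (_×-↔_)
open import Data.Sum.Base using (_⊎_; inj₁; inj₂)
open import Function.Bundles using (_↔_; Func; Inverse)
open import Function.Construct.Composition using (_↔-∘_)
open import Function.Construct.Symmetry using (↔-sym)
open import Level using (Level; 0ℓ)
open import Relation.Binary.Bundles using (Setoid)
open import Relation.Binary.Construct.Closure.ReflexiveTransitive using (Star)
open import Relation.Binary.Core using (Rel)
open import Relation.Binary.Definitions using (Decidable; Irreflexive; Symmetric)
open import Relation.Binary.PropositionalEquality
  using (_≡_; _≢_; refl; sym; subst; setoid)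
open import Relation.Nullary.Decidable using (Dec; yes; no; map′)

private
  variable
    ℓ : Level

record FiniteSet : Set₁ where
  field
    Carrier     : Set
    size        : ℕ
    enumeration : Carrier ↔ Fin size

open FiniteSet public using (Carrier; size)

infixr 2 _×ᶠ_

_×ᶠ_ : FiniteSet → FiniteSet → FiniteSet
U ×ᶠ V = record
  { Carrier     = Carrier U × Carrier V
  ; size        = size U * size V
  ; enumeration =
      ↔-sym *↔× ↔-∘ (FiniteSet.enumeration U ×-↔ FiniteSet.enumeration V)
  }

∃? : (V : FiniteSet) {P : Carrier V → Set ℓ} → (∀ x → Dec (P x)) → Dec (∃ P)
∃? V {P} P? =
  map′ (λ { (i , p) → from i , p })
       (λ { (x , p) → to x , subst P (sym (strictlyInverseʳ x)) p })
       (any? (λ i → P? (from i)))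
  where open Inverse (FiniteSet.enumeration V)

-- Finite simple graphs with vertex set V. Adjacency is required to be
-- decidable, which classically is no restriction. Proofs of adjacency need
-- not be unique; what depends on an edge must respect `SameEdge` below.
record Graph (V : FiniteSet) : Set₁ where
  field
    Adj         : Rel (Carrier V) 0ℓ
    symmetric   : Symmetric Adj
    irreflexive : Irreflexive _≡_ Adj
    adj?        : Decidable Adj

open Graph public using (Adj)

private
  variable
    U V : FiniteSet

Nontrivial : Graph V → Set
Nontrivial {V} _ = 2 ≤ size V

Connected : Graph V → Set
Connected {V} G = (x y : Carrier V) → Star (Adj G) x y

-- The two fibres of c are the parts of the bipartition.
Bipartite : Graph V → Set
Bipartite {V} G =
  Σ[ c ∈ (Carrier V → Bool) ] (∀ {x y} → Adj G x y → c x ≢ c y)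

Edge : Graph V → Set
Edge {V} G = Σ[ a ∈ Carrier V ] Σ[ b ∈ Carrier V ] Adj G a b

-- An element of `Edge G` carries an order of its ends; `SameEdge` forgets it,
-- so that the setoid `E G` is the set of (undirected) edges.
SameEdge : (G : Graph V) → Rel (Edge G) 0ℓ
SameEdge G (a , b , _) (c , d , _) = (a ≡ c × b ≡ d) ⊎ (a ≡ d × b ≡ c)

E : Graph V → Setoid 0ℓ 0ℓ
E G = record
  { Carrier       = Edge G
  ; _≈_           = SameEdge G
  ; isEquivalence = record
      { refl  = inj₁ (refl , refl)
      ; sym   = λ { (inj₁ (refl , refl)) → inj₁ (refl , refl)
                  ; (inj₂ (refl , refl)) → inj₂ (refl , refl) }
      ; trans = λ { (inj₁ (refl , refl)) q                    → q
                  ; (inj₂ (refl , refl)) (inj₁ (refl , refl)) → inj₂ (refl , refl)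
                  ; (inj₂ (refl , refl)) (inj₂ (refl , refl)) → inj₁ (refl , refl) }
      }
  }

-- In what follows Γ is a family of graphs on V indexed by I, and a function
-- from E(G) to Γ is given by the index of the graph chosen for each edge.
module _ {I : Set ℓ} (G : Graph U) (Γ : I → Graph V)
         (h : Func (E G) (setoid I)) where

  open Func h renaming (to to label; cong to label-cong)

  private
    relabel : ∀ {e f x y} → SameEdge G e f →
              Adj (Γ (label e)) x y → Adj (Γ (label f)) x y
    relabel {x = x} {y} e≈f = subst (λ i → Adj (Γ i) x y) (label-cong e≈f)

  product : Graph (U ×ᶠ V)
  product = record
    { Adj         = ⊗Adj
    ; symmetric   = λ { {a , x} {b , y} (ab , xy) →
        Graph.symmetric G ab ,
        relabel {a , b , ab} {b , a , Graph.symmetric G ab}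
          (inj₂ (refl , refl)) (Graph.symmetric (Γ (label (a , b , ab))) xy) }
    ; irreflexive = λ { refl (aa , _) → Graph.irreflexive G refl aa }
    ; adj?        = ⊗adj?
    }
    where
    ⊗Adj : Rel (Carrier U × Carrier V) 0ℓ
    ⊗Adj (a , x) (b , y) = Σ[ ab ∈ Adj G a b ] Adj (Γ (label (a , b , ab))) x y

    ⊗adj? : Decidable ⊗Adj
    ⊗adj? (a , x) (b , y) with Graph.adj? G a b
    ... | no ¬ab = no λ { (ab , _) → ¬ab ab }
    ... | yes ab =
      map′ (ab ,_)
           (λ { (ab′ , xy) → relabel {a , b , ab′} {a , b , ab} (inj₁ (refl , refl)) xy })
           (Graph.adj? (Γ (label (a , b , ab))) x y)

  -- The graph h(G).
  edgeUnion : Graph V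
  edgeUnion = record
    { Adj         = ∪Adj
    ; symmetric   = λ { (e , xy) → e , Graph.symmetric (Γ (label e)) xy }
    ; irreflexive = λ { refl (e , xx) → Graph.irreflexive (Γ (label e)) refl xx }
    ; adj?        = λ x y →
        map′ (λ { (a , b , ab , xy) → (a , b , ab) , xy })
             (λ { ((a , b , ab) , xy) → a , b , ab , xy })
             (∃? U λ a → ∃? U λ b → Graph.adj? product (a , x) (b , y))
    }
    where
    ∪Adj : Rel (Carrier V) 0ℓ
    ∪Adj x y = ∃[ e ] Adj (Γ (label e)) x y

infix 8 _⊗[_]_

_⊗[_]_ : {I : Set ℓ} (G : Graph U) → Func (E G) (setoid I) →
         (I → Graph V) → Graph (U ×ᶠ V)
G ⊗[ h ] Γ = product G Γ h

-- Write ~ for reachability in the product. For an edge ab of G and x ∈ V, every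
-- vertex of the product is ~ (a , x) or ~ (b , x): walking in Γ (h ab) covers
-- the fibres over a and b, and walking in G covers the others. Hence, if the
-- product is not connected, it has exactly two components, which separate
-- (a , x) from (b , x) for every edge ab and every x. The indicator c of a
-- component then satisfies c (a , x) ≢ c (b , x) for ab ∈ E(G), so a ↦ c (a , x)
-- is a 2-colouring of G, and x ↦ c (a , x) is one of h(G), because its edges xy
-- satisfy c (a , x) ≡ c (b , y) ≢ c (a , y) for some edge ab, and changing a to
-- a neighbour flips both colours. Conversely, 2-colourings c and d of G and
-- h(G) make c a xor d x constant on the components of the product.
module Submission where

open import Defs
open import Data.Bool.Base using (Bool; not; _xor_)
open import Data.Bool.Properties
  using (¬-not; not-¬; not-involutive; not-distribˡ-xor; not-distribʳ-xor)
  renaming (_≟_ to _≟ᵇ_)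
open import Data.Empty using (⊥-elim)
open import Data.Fin.Base using (Fin; zero; suc)
open import Data.Fin.Properties using (inj⇒≟)
open import Data.Fin.Subset.Properties using (anySubset?)
open import Data.List.Base using (List; []; _∷_; map; allFin)
open import Data.List.Membership.Propositional using (_∈_)
open import Data.List.Membership.Propositional.Properties using (∈-allFin; ∈-map⁺)
open import Data.List.Relation.Unary.Any using (here; there)
open import Data.Nat.Base using (_≤_; z≤n; s≤s)
open import Data.Product.Base using (∃; _×_; _,_; proj₁; proj₂)
open import Data.Sum.Base using (_⊎_; inj₁; inj₂; [_,_]′)
import Data.Sum.Base as Sum
open import Data.Vec.Base using (lookup; tabulate)
open import Data.Vec.Properties using (lookup∘tabulate)
open import Function.Base using (_∘_; id)
open import Function.Bundles using (Func; Inverse; _⇔_; mk⇔)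
open import Function.Properties.Inverse using (↔⇒↣)
open import Relation.Binary.Construct.Closure.ReflexiveTransitive
  using (Star; ε; _◅_; _◅◅_; reverse)
open import Relation.Binary.Definitions using (Decidable; DecidableEquality)
open import Relation.Binary.PropositionalEquality
  using (_≡_; _≢_; refl; sym; trans; cong; subst; setoid)
open import Relation.Nullary.Decidable
  using (Dec; yes; no; map′; does; does-⇔; ¬?; _×-dec_; _⊎-dec_; decidable-stable)
open import Relation.Nullary.Negation using (¬_)

private
  variable
    U V : FiniteSet

≡-dec : (V : FiniteSet) → DecidableEquality (Carrier V)
≡-dec V = inj⇒≟ (↔⇒↣ (FiniteSet.enumeration V))

elements : (V : FiniteSet) → List (Carrier V)
elements V = map from (allFin (size V))
  where open Inverse (FiniteSet.enumeration V)

∈-elements : (x : Carrier V) → x ∈ elements V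
∈-elements {V} x =
  subst (_∈ elements V) (strictlyInverseʳ x) (∈-map⁺ from (∈-allFin (to x)))
  where open Inverse (FiniteSet.enumeration V)

∃-distinct-Fin : ∀ {n} → 2 ≤ n → (i : Fin n) → ∃ λ j → i ≢ j
∃-distinct-Fin (s≤s (s≤s z≤n)) zero    = suc zero , λ ()
∃-distinct-Fin (s≤s (s≤s z≤n)) (suc i) = zero , λ ()

∃-distinct : (V : FiniteSet) → 2 ≤ size V → (x : Carrier V) → ∃ λ y → x ≢ y
∃-distinct V 2≤n x with ∃-distinct-Fin 2≤n (Inverse.to (FiniteSet.enumeration V) x)
... | j , i≢j = from j , λ x≡y → i≢j (trans (cong to x≡y) (strictlyInverseˡ j))
  where open Inverse (FiniteSet.enumeration V)

∃-element : (V : FiniteSet) → 2 ≤ size V → Carrier V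
∃-element V 2≤n = Inverse.from (FiniteSet.enumeration V) (first 2≤n)
  where
  first : ∀ {n} → 2 ≤ n → Fin n
  first (s≤s _) = zero

∃-neighbour : (F : Graph V) → Nontrivial F → Connected F → ∀ x → ∃ (Adj F x)
∃-neighbour {V} F nontrivial connected x with ∃-distinct V nontrivial x
... | y , x≢y with connected x y
... | ε      = ⊥-elim (x≢y refl)
... | xz ◅ _ = _ , xz

module Reachability (F : Graph V) where

  -- Walks all of whose inner vertices lie in the given list, as in the
  -- Floyd–Warshall algorithm.
  Via : List (Carrier V) → Carrier V → Carrier V → Set
  Via []       x y = x ≡ y ⊎ Adj F x y
  Via (z ∷ zs) x y = Via zs x y ⊎ (Via zs x z × Via zs z y)

  via? : ∀ zs → Decidable (Via zs)
  via? []       x y = ≡-dec V x y ⊎-dec Graph.adj? F x y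
  via? (z ∷ zs) x y = via? zs x y ⊎-dec (via? zs x z ×-dec via? zs z y)

  via⇒star : ∀ zs {x y} → Via zs x y → Star (Adj F) x y
  via⇒star []       (inj₁ refl)    = ε
  via⇒star []       (inj₂ xy)      = xy ◅ ε
  via⇒star (z ∷ zs) (inj₁ xy)      = via⇒star zs xy
  via⇒star (z ∷ zs) (inj₂ (p , q)) = via⇒star zs p ◅◅ via⇒star zs q

  via-base : ∀ zs {x y} → x ≡ y ⊎ Adj F x y → Via zs x y
  via-base []       xy = xy
  via-base (z ∷ zs) xy = inj₁ (via-base zs xy)

  -- Repeated visits are cut out: at the head `z`, any closed part at `z` is dropped; if both walks
  -- pass through a head `w`, the piece between the first and last visit to `w` is dropped.
  via-trans : ∀ {zs x y z} → z ∈ zs → Via zs x z → Via zs z y → Via zs x y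
  via-trans (here refl) p q = inj₂ ([ id , proj₁ ]′ p , [ id , proj₂ ]′ q)
  via-trans (there z∈)  (inj₁ xz)        (inj₁ zy)        = inj₁ (via-trans z∈ xz zy)
  via-trans (there z∈)  (inj₁ xz)        (inj₂ (zw , wy)) = inj₂ (via-trans z∈ xz zw , wy)
  via-trans (there z∈)  (inj₂ (xw , wz)) (inj₁ zy)        = inj₂ (xw , via-trans z∈ wz zy)
  via-trans (there z∈)  (inj₂ (xw , _))  (inj₂ (_ , wy))  = inj₂ (xw , wy)

  star⇒via : ∀ {x y} → Star (Adj F) x y → Via (elements V) x y
  star⇒via ε        = via-base (elements V) (inj₁ refl)
  star⇒via (xz ◅ p) =
    via-trans (∈-elements {V} _) (via-base (elements V) (inj₂ xz)) (star⇒via p)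

  -- This makes the indicator of a component a `Bool`-valued function.
  star? : Decidable (Star (Adj F))
  star? x y = map′ (via⇒star (elements V)) star⇒via (via? (elements V) x y)

-- Up to pointwise equality a colouring is a subset of `Fin (size V)`, so an exhaustive search for
-- one without a monochromatic edge decides the question. The theorem needs the answer for `G` to
-- select a disjunct.
bipartite? : (F : Graph V) → Dec (Bipartite F)
bipartite? {V} F = map′
  (λ (s , ¬mono) → lookup s ∘ to , λ xy same → ¬mono (_ , _ , xy , same))
  (λ (c , proper) → tabulate (c ∘ from) , λ (x , y , xy , same) →
    proper xy (trans (sym (lookup-colours c x)) (trans same (lookup-colours c y))))
  (anySubset? λ s → ¬? (∃? V λ x → ∃? V λ y →
    Graph.adj? F x y ×-dec (lookup s (to x) ≟ᵇ lookup s (to y))))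
  where
  open Inverse (FiniteSet.enumeration V)

  lookup-colours : (c : Carrier V → Bool) → ∀ x → lookup (tabulate (c ∘ from)) (to x) ≡ c x
  lookup-colours c x = trans (lookup∘tabulate (c ∘ from) (to x)) (cong c (strictlyInverseʳ x))

does-≢ : ∀ {a b} {A : Set a} {B : Set b} (A? : Dec A) (B? : Dec B) →
         ¬ (A × B) → A ⊎ B → does A? ≢ does B?
does-≢ (yes a) (yes b) ¬both _      _ = ¬both (a , b)
does-≢ (no ¬a) (no ¬b) _     either _ = [ ¬a , ¬b ]′ either
does-≢ (yes _) (no _)  _     _      ()
does-≢ (no _)  (yes _) _     _      ()

≢-xor-≢ : ∀ {a b c d} → a ≢ b → c ≢ d → a xor c ≡ b xor d
≢-xor-≢ {a} {b} {c} {d} a≢b c≢d rewrite ¬-not a≢b | ¬-not c≢d =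
  trans (sym (not-distribˡ-xor b (not d)))
    (trans (cong not (sym (not-distribʳ-xor b d))) (not-involutive (b xor d)))

≢-xor : ∀ {a b} c → a ≢ b → a xor c ≢ b xor c
≢-xor {a} {b} c a≢b rewrite ¬-not a≢b =
  not-¬ refl ∘ sym ∘ trans (not-distribˡ-xor b c)

≡-flip : ∀ {a b c d : Bool} → a ≢ b → c ≢ d → a ≡ c → b ≡ d
≡-flip a≢b c≢d refl = trans (¬-not (a≢b ∘ sym)) (sym (¬-not (c≢d ∘ sym)))

module _ {ℓ} {I : Set ℓ} (G : Graph U) (Γ : I → Graph V)
         (nontrivial : ∀ i → Nontrivial (Γ i)) (connected : ∀ i → Connected (Γ i))
         (connectedG : Connected G) (h : Func (E G) (setoid I)) where

  open Func h using () renaming (to to label)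

  private
    P : Graph (U ×ᶠ V)
    P = G ⊗[ h ] Γ

    infix 4 _~_

    _~_ : Carrier (U ×ᶠ V) → Carrier (U ×ᶠ V) → Set
    _~_ = Star (Adj P)

    ~-sym : ∀ {p q} → p ~ q → q ~ p
    ~-sym = reverse λ {p} {q} → Graph.symmetric P {p} {q}

  two-classes : ∀ {a b} → Adj G a b → ∀ x p → p ~ (a , x) ⊎ p ~ (b , x)
  two-classes {a} {b} ab x (c , z) = fibre (connectedG c a) z
    where
    Covered : Carrier (U ×ᶠ V) → Set
    Covered p = p ~ (a , x) ⊎ p ~ (b , x)

    step : ∀ {p q} → Adj P p q → Covered q → Covered p
    step pq = Sum.map (pq ◅_) (pq ◅_)

    -- An edge `yy′` of the label of `ab` joins `(a , y)` to `(b , y′)` and `(b , y)` to `(a , y′)`.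
    -- Each step of the walk swaps the two fibres, so both claims go through the induction together.
    end-fibres : ∀ {y} → Star (Adj (Γ (label (a , b , ab)))) y x →
                 Covered (a , y) × Covered (b , y)
    end-fibres ε       = inj₁ ε , inj₂ ε
    end-fibres {y} (_◅_ {j = y′} yy′ w) with end-fibres w
    ... | cov-a , cov-b =
      step (ab , yy′) cov-b ,
      step (Graph.symmetric P {a , y′} {b , y}
              (ab , Graph.symmetric (Γ (label (a , b , ab))) yy′)) cov-a

    -- A step `cd` in `G` lifts to the product by moving `y` to any neighbour in the label of `cd`.
    -- That neighbour is arbitrary, hence the claim for all `y`.
    fibre : ∀ {c} → Star (Adj G) c a → ∀ y → Covered (c , y)
    fibre ε y = proj₁ (end-fibres (connected (label (a , b , ab)) y x))
    fibre {c} (_◅_ {j = d} cd w) y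
      with ∃-neighbour (Γ i) (nontrivial i) (connected i) y
      where i = label (c , d , cd)
    ... | y′ , yy′ = step (cd , yy′) (fibre w y′)

  module Disconnected {p q} (p≁q : ¬ p ~ q) where

    open Reachability P using (star?)

    colour : Carrier (U ×ᶠ V) → Bool
    colour z = does (star? p z)

    colour-~ : ∀ {y z} → y ~ z → colour y ≡ colour z
    colour-~ {y} {z} y~z =
      does-⇔ (mk⇔ (_◅◅ y~z) (_◅◅ ~-sym y~z)) (star? p y) (star? p z)

    -- By `two-classes`, `p` reaches one of the two vertices, and so does `q`. If `p` reached both,
    -- it would therefore reach `q`.
    colour-edge : ∀ {a b} → Adj G a b → ∀ x → colour (a , x) ≢ colour (b , x)
    colour-edge {a} {b} ab x = does-≢ (star? p (a , x)) (star? p (b , x))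
      (λ (p~ax , p~bx) →
        p≁q ([ (λ q~ax → p~ax ◅◅ ~-sym q~ax) , (λ q~bx → p~bx ◅◅ ~-sym q~bx) ]′
               (two-classes ab x q)))
      (two-classes ab x p)

    bipartiteG : Bipartite G
    bipartiteG = (λ a → colour (a , proj₂ p)) , λ ab → colour-edge ab (proj₂ p)

    colour-fibre : ∀ {a b} → Star (Adj G) a b → ∀ {x y} →
                   colour (a , x) ≡ colour (a , y) → colour (b , x) ≡ colour (b , y)
    colour-fibre ε        same = same
    colour-fibre (ac ◅ w) same =
      colour-fibre w (≡-flip (colour-edge ac _) (colour-edge ac _) same)

    bipartite∪ : Bipartite (edgeUnion G Γ h)
    bipartite∪ = (λ x → colour (proj₁ p , x)) , λ { {y = y} ((a , b , ab) , xy) same →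
      -- `same` concerns the fibre over `proj₁ p`, while `xy` comes from an edge at `a`;
      -- `colour-fibre` carries the equality over to `a`.
      colour-edge ab y
        (trans (sym (colour-fibre (connectedG (proj₁ p) a) same))
               (colour-~ ((ab , xy) ◅ ε))) }

  ¬bipartite⇒connected : ¬ Bipartite G ⊎ ¬ Bipartite (edgeUnion G Γ h) → Connected P
  -- Reachability is decidable, so it may be proved by contradiction.
  ¬bipartite⇒connected ¬bip p q = decidable-stable (Reachability.star? P p q) λ p≁q →
    let open Disconnected p≁q in [ (λ ¬bG → ¬bG bipartiteG) , (λ ¬b∪ → ¬b∪ bipartite∪) ]′ ¬bip

  bipartite⇒¬connected : Nontrivial G → Bipartite G → Bipartite (edgeUnion G Γ h) →
                         ¬ Connected P
  bipartite⇒¬connected nontrivialG (c , c-proper) (d , d-proper) connectedP =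
    -- The two vertices share `x`, so their invariants differ through `c` alone.
    ≢-xor (d x) (c-proper ab) (invariant (connectedP (a , x) (b , x)))
    where
    invariant : ∀ {a b x y} → (a , x) ~ (b , y) → c a xor d x ≡ c b xor d y
    invariant ε = refl
    invariant ((ab , xy) ◅ w) =
      -- A product edge flips both colours, which preserves their xor.
      trans (≢-xor-≢ (c-proper ab) (d-proper ((_ , _ , ab) , xy))) (invariant w)

    a : Carrier U
    a = ∃-element U nontrivialG

    b : Carrier U
    b = proj₁ (∃-neighbour G nontrivialG connectedG a)

    ab : Adj G a b
    ab = proj₂ (∃-neighbour G nontrivialG connectedG a)

    -- The edge `ab` yields a member of the family, whose nontriviality provides a vertex in `V`.
    x : Carrier V
    x = ∃-element V (nontrivial (label (a , b , ab)))

theorem2p1 : ∀ {ℓ} {U V : FiniteSet} {I : Set ℓ}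
    (G : Graph U) (Γ : I → Graph V) →
    Nontrivial G → Connected G →
    (∀ i → Nontrivial (Γ i)) → (∀ i → Connected (Γ i)) →
    (h : Func (E G) (setoid I)) →
    Connected (G ⊗[ h ] Γ) ⇔ (¬ Bipartite G ⊎ ¬ Bipartite (edgeUnion G Γ h))
theorem2p1 G Γ nontrivialG connectedG nontrivial connected h = mk⇔ to from
  where
  to : Connected (G ⊗[ h ] Γ) → ¬ Bipartite G ⊎ ¬ Bipartite (edgeUnion G Γ h)
  to connectedP with bipartite? G
  ... | no ¬bipartiteG = inj₁ ¬bipartiteG
  ... | yes bipartiteG = inj₂ λ bipartite∪ →
    bipartite⇒¬connected G Γ nontrivial connected connectedG h
      nontrivialG bipartiteG bipartite∪ connectedP

  from : ¬ Bipartite G ⊎ ¬ Bipartite (edgeUnion G Γ h) → Connected (G ⊗[ h ] Γ)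
  from = ¬bipartite⇒connected G Γ nontrivial connected connectedG h
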